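{- Let $G$ be a directed graph in which every vertex has finitely many out-neighbours, let $\Gamma=\mathcal{C}(G)$ be its clausal theory, and let $C\subseteq\ddot G$ be a clause. (1) $C$ is derivable from $\Gamma$ in RES extended with the rules (aW) and (bW) if and only if $\Gamma\models C$. (2) $C$ is derivable from $\Gamma$ in RES extended with the rule (cW) if and only if $\Gamma\models_c C$.
   Context: A graph is a directed graph $G=\langle G,A_G\rangle$, $A_G\subseteq G\times G$ (loops allowed). Put $A_G(x)=\{y\mid (x,y)\in A_G\}$, $A^-_G(x)=\{y\mid x\in A_G(y)\}$; for $X\subseteq G$, $A_G(X)=\bigcup_{x\in X}A_G(x)$, $A^-_G(X)=\bigcup_{x\in X}A^-_G(x)$, $A^-_G[X]=X\cup A^-_G(X)$. Vertices are propositional atoms. For $X\subseteq G$, $\ddot X=X\cup\{\overline x\mid x\in X\}$ is the set of literals over $X$ ($\overline x$ is the negation of $x$). A clause is a finite set of literals, read disjunctively; $\{\}$ is the empty clause. The clausal theory $\mathcal{C}(G)$ contains, for each $x\in G$, the clause $\{x\}\cup A_G(x)$ and, for each $y\in A_G(x)$, the clause $\{\overline x,\overline y\}$. The system RES consists of the axioms $\{a,\overline a\}$ for every atom $a\in G$ and the resolution rule: from $A\cup\{a\}$ and $B\cup\{\overline a\}$ infer $A\cup B$. $G^\bot$ is the set of atoms $x\in G$ such that both $\{x\}$ and $\{\overline x\}$ are derivable from $\Gamma$ in RES. Additional rules (all clauses are over the literals $\ddot G$): (aW) from $B$ infer $B\cup C$, provided $B\not\subseteq\ddot{G^\bot}$;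 (bW) if $A$ is a nonempty clause such that for every atom $a$ occurring (positively or negatively) in $A$ both $\{a\}$ and $\{\overline a\}$ are derived, infer $A$; (cW) from $B$ infer $B\cup C$, without restriction. A semikernel of $G$ is a set $S\subseteq G$ with $A_G(S)\subseteq A^-_G(S)\subseteq G\setminus S$; $SK(G)$ is the set of semikernels. $\mathrm{Mod}(G)$ is the set of all $S\in SK(G)$ such that $A^-_G(A^-_G[S])\subseteq A^-_G[S]$ and there is no $R\in SK(G)$ with $A^-_G(A^-_G[R])\subseteq A^-_G[R]$ and $A^-_G[S]\subsetneq A^-_G[R]$. A 3-partition of $G$ is a triple $\alpha=\langle\alpha^{\mathbf 1},\alpha^{\mathbf 0},\alpha^\bot\rangle$ of pairwise disjoint (possibly empty) sets with union $G$. For a clause $C$ with set of positively occurring atoms $P$ and set of negatively occurring atoms $N$, $\alpha\models C$ iff $P\cap\alpha^{\mathbf 1}\neq\emptyset$, or $N\cap\alpha^{\mathbf 0}\neq\emptyset$, or ($P\cup N\subseteq\alpha^\bot$ and $\alpha^\bot\neq\emptyset$). For $S\in\mathrm{Mod}(G)$ let $\alpha_S=\langle S,\,A^-_G(S),\,G\setminus A^-_G[S]\rangle$. $\Gamma\models C$ means that $\alpha_S\models C$ for every $S\in\mathrm{Mod}(G)$. $\Gamma\models_c C$ is the classical consequence relation: every classical valuation of the atoms $G$ satisfying all clauses of $\Gamma$ satisfies $C$. -}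

module Defs where

open import Axiom.ExcludedMiddle using (ExcludedMiddle)
open import Data.Bool using (Bool; true; not)
open import Data.List using (List; []; _∷_; [_]; _++_; map)
open import Data.List.Membership.Propositional using (_∈_)
open import Data.List.Relation.Binary.BagAndSetEquality using (_∼[_]_; set)
open import Data.List.Relation.Unary.All using (All)
open import Data.List.Relation.Unary.Any using (Any)
open import Data.Product using (∃; ∃-syntax; _×_; _,_)
open import Data.Sum using (_⊎_; inj₁; inj₂)
open import Function.Bundles using (_⇔_)
open import Level using (Level; suc)
open import Relation.Binary.Core using (Rel)
open import Relation.Binary.PropositionalEquality using (_≡_; _≢_)
open import Relation.Nullary using (¬_; yes; no)
open import Relation.Unary using
  (Pred; _⊆_; _⊂_; _∪_; _∩_; ∁; _≬_; Empty; Satisfiable; Universal)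

record Graph (ℓ : Level) : Set (suc ℓ) where
  field
    V   : Set ℓ
    _⟶_ : Rel V ℓ

open Graph using (V)

FinitelyBranching : ∀ {ℓ} → Graph ℓ → Set ℓ
FinitelyBranching G = ∀ x → ∃[ ys ] (∀ y → y ∈ ys ⇔ x ⟶ y)
  where open Graph G using (_⟶_)

data Literal {ℓ} (A : Set ℓ) : Set ℓ where
  pos neg : A → Literal A

atom : ∀ {ℓ} {A : Set ℓ} → Literal A → A
atom (pos x) = x
atom (neg x) = x

-- A clause is a finite set of literals, represented by a list.  Lists with the
-- same elements are the same clause: each proof system below has a rule `resp`
-- for this, and the semantic notions depend on membership only.
Clause : ∀ {ℓ} → Set ℓ → Set ℓ
Clause A = List (Literal A)

Theory : ∀ {ℓ} → Set ℓ → Set (suc ℓ)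
Theory {ℓ} A = Pred (Clause A) ℓ

positives negatives : ∀ {ℓ} {A : Set ℓ} → Clause A → Pred A ℓ
positives C x = pos x ∈ C
negatives C x = neg x ∈ C

data 𝒞 {ℓ} (G : Graph ℓ) : Theory (V G) where
  out      : ∀ x ys → (∀ y → y ∈ ys ⇔ Graph._⟶_ G x y) →
             𝒞 G (pos x ∷ map pos ys)
  conflict : ∀ {x y} → Graph._⟶_ G x y → 𝒞 G (neg x ∷ neg y ∷ [])

module _ {ℓ} {A : Set ℓ} where

  infix 4 _⊢_ _⊢ᵃᵇ_ _⊢ᶜ_ _⊨ᶜ_

  -- RES
  data _⊢_ (Γ : Theory A) : Clause A → Set ℓ where
    hyp  : ∀ {C} → Γ C → Γ ⊢ C
    ax   : ∀ a → Γ ⊢ pos a ∷ neg a ∷ []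
    res  : ∀ {a B C} → Γ ⊢ pos a ∷ B → Γ ⊢ neg a ∷ C → Γ ⊢ B ++ C
    resp : ∀ {B C} → B ∼[ set ] C → Γ ⊢ B → Γ ⊢ C

  -- G^⊥, determined by RES without any additional rule
  Paradoxical : Theory A → Pred A ℓ
  Paradoxical Γ x = (Γ ⊢ [ pos x ]) × (Γ ⊢ [ neg x ])

  -- RES + (aW) + (bW)
  data _⊢ᵃᵇ_ (Γ : Theory A) : Clause A → Set ℓ where
    hyp  : ∀ {C} → Γ C → Γ ⊢ᵃᵇ C
    ax   : ∀ a → Γ ⊢ᵃᵇ pos a ∷ neg a ∷ []
    res  : ∀ {a B C} → Γ ⊢ᵃᵇ pos a ∷ B → Γ ⊢ᵃᵇ neg a ∷ C → Γ ⊢ᵃᵇ B ++ C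
    resp : ∀ {B C} → B ∼[ set ] C → Γ ⊢ᵃᵇ B → Γ ⊢ᵃᵇ C
    aW   : ∀ {B} C → ¬ All (λ l → Paradoxical Γ (atom l)) B →
           Γ ⊢ᵃᵇ B → Γ ⊢ᵃᵇ B ++ C
    bW   : ∀ {B} → B ≢ [] →
           (∀ {a} → a ∈ map atom B → (Γ ⊢ᵃᵇ [ pos a ]) × (Γ ⊢ᵃᵇ [ neg a ])) →
           Γ ⊢ᵃᵇ B

  -- RES + (cW)
  data _⊢ᶜ_ (Γ : Theory A) : Clause A → Set ℓ where
    hyp  : ∀ {C} → Γ C → Γ ⊢ᶜ C
    ax   : ∀ a → Γ ⊢ᶜ pos a ∷ neg a ∷ []
    res  : ∀ {a B C} → Γ ⊢ᶜ pos a ∷ B → Γ ⊢ᶜ neg a ∷ C → Γ ⊢ᶜ B ++ C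
    resp : ∀ {B C} → B ∼[ set ] C → Γ ⊢ᶜ B → Γ ⊢ᶜ C
    cW   : ∀ {B} C → Γ ⊢ᶜ B → Γ ⊢ᶜ B ++ C

  value : (A → Bool) → Literal A → Bool
  value v (pos x) = v x
  value v (neg x) = not (v x)

  Satisfies : (A → Bool) → Clause A → Set ℓ
  Satisfies v C = Any (λ l → value v l ≡ true) C

  _⊨ᶜ_ : Theory A → Clause A → Set ℓ
  Γ ⊨ᶜ C = ∀ v → (∀ {D} → Γ D → Satisfies v D) → Satisfies v C

  record Triple : Set (suc ℓ) where
    constructor ⟨_,_,_⟩
    field
      𝟏 𝟎 bot : Pred A ℓ

  record Is3Partition (α : Triple) : Set ℓ where
    open Triple α
    field
      𝟏∩𝟎   : Empty (𝟏 ∩ 𝟎)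
      𝟏∩bot : Empty (𝟏 ∩ bot)
      𝟎∩bot : Empty (𝟎 ∩ bot)
      cover : Universal (𝟏 ∪ 𝟎 ∪ bot)

  infix 4 _⊩_

  _⊩_ : Triple → Clause A → Set ℓ
  α ⊩ C = (positives C ≬ 𝟏)
        ⊎ (negatives C ≬ 𝟎)
        ⊎ ((positives C ∪ negatives C ⊆ bot) × Satisfiable bot)
    where open Triple α

module _ {ℓ} (G : Graph ℓ) where
  open Graph G using (_⟶_)

  Out In In[_] : Pred (V G) ℓ → Pred (V G) ℓ
  Out X y = ∃[ x ] X x × x ⟶ y
  In  X y = ∃[ x ] X x × y ⟶ x
  In[ X ] = X ∪ In X

  Semikernel : Pred (V G) ℓ → Set ℓ
  Semikernel S = (Out S ⊆ In S) × (In S ⊆ ∁ S)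

  InClosed : Pred (V G) ℓ → Set ℓ
  InClosed S = In In[ S ] ⊆ In[ S ]

  Mod : Pred (V G) ℓ → Set (suc ℓ)
  Mod S = Semikernel S × InClosed S ×
          ¬ (∃[ R ] Semikernel R × InClosed R × In[ S ] ⊂ In[ R ])

  partition : Pred (V G) ℓ → Triple
  partition S = ⟨ S , In S , ∁ In[ S ] ⟩

  partition-is3Partition : ExcludedMiddle ℓ → ∀ {S} → Semikernel S →
                           Is3Partition (partition S)
  partition-is3Partition em {S} (_ , In⊆∁) = record
    { 𝟏∩𝟎   = λ { _ (s , i) → In⊆∁ i s }
    ; 𝟏∩bot = λ { _ (s , n) → n (inj₁ s) }
    ; 𝟎∩bot = λ { _ (i , n) → n (inj₂ i) }
    ; cover = cover
    }
    where
    cover : Universal (S ∪ In S ∪ ∁ In[ S ])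
    cover x with em {P = In[ S ] x}
    ... | yes (inj₁ s) = inj₁ s
    ... | yes (inj₂ i) = inj₂ (inj₁ i)
    ... | no  n        = inj₂ (inj₂ n)

infix 4 _⊨_

_⊨_ : ∀ {ℓ} (G : Graph ℓ) → Clause (V G) → Set (suc ℓ)
G ⊨ C = ∀ S → Mod G S → partition G S ⊩ C

{-# OPTIONS --safe #-}
-- Completeness of resolution: if no derivable clause is contained in C, extend C
-- to a maximal set of literals containing no derivable clause.  Closure under
-- resolution makes it contain a literal of every atom, so making its literals
-- false gives a valuation satisfying every derivable clause and refuting C.  With
-- (cW) this is part (2).
--
-- For part (1), finite branching makes G^⊥ closed under out-neighbours, and the
-- nonempty derivable clauses without paradoxical atoms are closed under
-- resolution.  A valuation satisfying them is a semikernel S with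
-- A⁻[S] = G ∖ G^⊥.  Conversely RES is sound for every in-closed semikernel R, so
-- A⁻[R] avoids G^⊥.  Hence Mod(G) consists of the in-closed semikernels S with
-- A⁻[S] = G ∖ G^⊥, and G^⊥ is the ⊥-part of all of them.
module Submission where

open import Defs
open import Axiom.ExcludedMiddle using (ExcludedMiddle)
open import Axiom.Extensionality.Propositional using (Extensionality)
open import Data.Bool using (Bool; true; false; not)
open import Data.Bool.Properties using (T-≡; ⇔→≡; not-injective)
open import Data.Empty using (⊥-elim)
open import Data.List using (List; []; _∷_; [_]; _++_; map; filter)
open import Data.List.Membership.Propositional using (_∈_; find; lose)
open import Data.List.Membership.Propositional.Properties
  using (∈-++⁺ˡ; ∈-++⁺ʳ; ∈-++⁻; ∈-map⁺; ∈-map⁻; ∈-filter⁺; ∈-filter⁻)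
open import Data.List.Properties using (++-identityʳ; ++-conicalˡ; ++-conicalʳ)
open import Data.List.Relation.Binary.BagAndSetEquality
  using (_∼[_]_; set; bag-=⇒; ↭⇒∼bag)
open import Data.List.Relation.Binary.Permutation.Propositional using (↭-sym)
open import Data.List.Relation.Binary.Permutation.Propositional.Properties using (shift)
open import Data.List.Relation.Unary.All as All using (All; []; _∷_)
open import Data.List.Relation.Unary.Any as Any using (Any; here; there)
import Data.List.Relation.Unary.Any.Properties as Any
open import Data.Product using (∃; ∃-syntax; _×_; _,_; proj₁; proj₂)
open import Data.Sum as Sum using (_⊎_; inj₁; inj₂; [_,_]′)
open import Function using (_∘_; id; case_of_)
open import Function.Bundles using (_⇔_; mk⇔; Equivalence)
open import Level using (Level) renaming (suc to lsuc)
open import Relation.Binary.PropositionalEquality using (_≡_; _≢_; refl; sym; trans; cong; subst)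
open import Relation.Nullary using (¬_; yes; no)
open import Relation.Nullary.Decidable using (⌊_⌋; toWitness; fromWitness; decidable-stable; ¬?)
open import Relation.Unary using (Pred; Decidable; ∁) renaming (_⊆_ to _⊑_)

open Graph using (V)

private
  variable
    ℓ : Level
    A L : Set ℓ

-- Clauses as sets, and Boolean-valued subsets.

absorb : {B C : List L} → All (_∈ C) B → B ++ C ∼[ set ] C
absorb {B = B} B⊆C = mk⇔ ([ All.lookup B⊆C , id ]′ ∘ ∈-++⁻ B) (∈-++⁺ʳ B)

-- Boolean values keep the type of all subsets in the universe of `L`, so that subsets can index
-- joins. Extensionality turns mutual inclusion into equality.
Subset : Set ℓ → Set ℓ
Subset L = L → Bool

infix 4 _∈ˢ_ _⊆_

_∈ˢ_ : L → Subset L → Set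
l ∈ˢ X = X l ≡ true

_⊆_ : Subset L → Subset L → Set _
X ⊆ Y = ∀ {l} → l ∈ˢ X → l ∈ˢ Y

module Classical (em : ∀ {a} → ExcludedMiddle a) (ext : ∀ {a b} → Extensionality a b) where

  by-contradiction : ∀ {p} {P : Set p} → ¬ ¬ P → P
  by-contradiction = decidable-stable em

  opaque
    ⟦_⟧ : ∀ {p} → Pred L p → Subset L
    ⟦ P ⟧ l = ⌊ em {P = P l} ⌋

    ∈⟦⟧⁺ : ∀ {p} {P : Pred L p} {l} → P l → l ∈ˢ ⟦ P ⟧
    ∈⟦⟧⁺ = Equivalence.to T-≡ ∘ fromWitness

    ∈⟦⟧⁻ : ∀ {p} {P : Pred L p} {l} → l ∈ˢ ⟦ P ⟧ → P l
    ∈⟦⟧⁻ = toWitness ∘ Equivalence.from T-≡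

  ⊆-antisym : {X Y : Subset L} → X ⊆ Y → Y ⊆ X → X ≡ Y
  ⊆-antisym X⊆Y Y⊆X = ext λ l → ⇔→≡ (mk⇔ X⊆Y Y⊆X)

  -- The Bourbaki–Witt argument: iterating `next` transfinitely without ordinals.
  module Tower {ℓ} {L : Set ℓ} (base : Subset L)
    (next : Subset L → Subset L) (inflationary : ∀ X → X ⊆ next X) where

    -- `base` is put into every join, so that the empty family yields the first stage.
    join : {I : Set ℓ} → (I → Subset L) → Subset L
    join F = ⟦ (λ l → l ∈ˢ base ⊎ ∃[ i ] l ∈ˢ F i) ⟧

    data Stage : Subset L → Set (lsuc ℓ) where
      next-stage : ∀ {X} → Stage X → Stage (next X)
      join-stage : ∀ {I} {F : I → Subset L} → (∀ i → Stage (F i)) → Stage (join F)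

    base⊆ : ∀ {X} → Stage X → base ⊆ X
    base⊆ (next-stage s) = inflationary _ ∘ base⊆ s
    base⊆ (join-stage _) = ∈⟦⟧⁺ ∘ inj₁

    ⊆join : ∀ {I} (F : I → Subset L) i → F i ⊆ join F
    ⊆join F i l∈Fi = ∈⟦⟧⁺ (inj₂ (i , l∈Fi))

    join⊆ : ∀ {I} {F : I → Subset L} {X} → base ⊆ X → (∀ i → F i ⊆ X) → join F ⊆ X
    join⊆ b f l∈ with ∈⟦⟧⁻ l∈
    ... | inj₁ l∈base     = b l∈base
    ... | inj₂ (i , l∈Fi) = f i l∈Fi

    -- The extreme points of the Bourbaki-Witt argument: no step of `next` from strictly below `X`
    -- leads beyond `X`.
    Extreme : Subset L → Set (lsuc ℓ)
    Extreme X = ∀ {Y} → Stage Y → Y ⊆ X → ¬ (X ⊆ Y) → next Y ⊆ X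

    compare : ∀ {X} → Stage X → Extreme X → ∀ {Y} → Stage Y → (Y ⊆ X) ⊎ (next X ⊆ Y)
    compare sX eX (next-stage {Y} sY) with compare sX eX sY
    ... | inj₂ nX⊆Y = inj₂ (inflationary Y ∘ nX⊆Y)
    ... | inj₁ Y⊆X with em {P = _ ⊆ Y}
    -- Here `Y` equals `X`, so the two successors coincide.
    ...   | yes X⊆Y = inj₂ (subst (λ Z → next Z ⊆ next Y) (⊆-antisym Y⊆X X⊆Y) id)
    ...   | no  X⊈Y = inj₁ (eX sY Y⊆X X⊈Y)
    compare {X} sX eX (join-stage {F = F} sF) with em {P = ∃[ i ] next X ⊆ F i}
    ... | yes (i , nX⊆Fi) = inj₂ λ l∈ → ⊆join F i (nX⊆Fi l∈)
    ... | no  none        = inj₁ (join⊆ (base⊆ sX) F⊆X)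
      where
      F⊆X : ∀ i → F i ⊆ X
      F⊆X i with compare sX eX (sF i)
      ... | inj₁ Fi⊆X  = Fi⊆X
      ... | inj₂ nX⊆Fi = ⊥-elim (none (i , nX⊆Fi))

    extreme : ∀ {X} → Stage X → Extreme X
    extreme (next-stage {X} sX) {Y} sY Y⊆nX nX⊈Y with compare sX (extreme sX) sY
    ... | inj₂ nX⊆Y = ⊥-elim (nX⊈Y nX⊆Y)
    ... | inj₁ Y⊆X with em {P = X ⊆ Y}
    ...   | yes X⊆Y = subst (λ Z → next Y ⊆ next Z) (⊆-antisym Y⊆X X⊆Y) id
    ...   | no  X⊈Y = inflationary X ∘ extreme sX sY Y⊆X X⊈Y
    extreme (join-stage {F = F} sF) {Y} sY Y⊆J J⊈Y with em {P = ∃[ i ] ¬ (F i ⊆ Y)}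
    ... | no none = ⊥-elim (J⊈Y (join⊆ (base⊆ sY) λ i →
            by-contradiction λ Fi⊈Y → none (i , Fi⊈Y)))
    -- `Y` does not exhaust `F i`, so comparability puts it strictly below `F i`, whose extremeness
    -- bounds `next Y`.
    ... | yes (i , Fi⊈Y) with compare (sF i) (extreme (sF i)) sY
    ...   | inj₁ Y⊆Fi  = ⊆join F i ∘ extreme (sF i) sY Y⊆Fi Fi⊈Y
    ...   | inj₂ nFi⊆Y = ⊥-elim (Fi⊈Y (nFi⊆Y ∘ inflationary (F i)))

    chain : ∀ {X Y} → Stage X → Stage Y → (X ⊆ Y) ⊎ (Y ⊆ X)
    chain sX sY with compare sX (extreme sX) sY
    ... | inj₁ Y⊆X  = inj₂ Y⊆X
    ... | inj₂ nX⊆Y = inj₁ (nX⊆Y ∘ inflationary _)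

    -- Indexing by the characteristic function of Stage keeps the index type
    -- in Set ℓ although Stage itself lives one universe higher.
    top-family : (∃[ X ] X ∈ˢ ⟦ Stage ⟧) → Subset L
    top-family = proj₁

    top : Subset L
    top = join top-family

    top-stage : Stage top
    top-stage = join-stage (∈⟦⟧⁻ ∘ proj₂)

    top-fixed : next top ⊆ top
    top-fixed = ⊆join top-family (next top , ∈⟦⟧⁺ (next-stage top-stage))

  -- The Teichmüller–Tukey lemma for sets containing none of the given finite lists.
  module Maximal {ℓ} {L : Set ℓ} (Bad : Pred (List L) ℓ) where

    Consistent : Subset L → Set ℓ
    Consistent X = ∀ {B} → Bad B → ¬ All (_∈ˢ X) B

    insert : Subset L → L → Subset L
    insert X l = ⟦ (λ m → m ∈ˢ X ⊎ m ≡ l) ⟧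

    Addable : Subset L → L → Set ℓ
    Addable X l = ¬ l ∈ˢ X × Consistent (insert X l)

    next : Subset L → Subset L
    next X with em {P = ∃ (Addable X)}
    ... | yes (l , _) = insert X l
    ... | no  _       = X

    next-inflationary : ∀ X → X ⊆ next X
    next-inflationary X l∈X with em {P = ∃ (Addable X)}
    ... | yes _ = ∈⟦⟧⁺ (inj₁ l∈X)
    ... | no  _ = l∈X

    next-consistent : ∀ {X} → Consistent X → Consistent (next X)
    next-consistent {X} cX with em {P = ∃ (Addable X)}
    ... | yes (_ , _ , c) = c
    ... | no  _           = cX

    -- The element that `next` would insert need not be `l`: any addable element contradicts
    -- fixedness.
    fixed⇒maximal : ∀ {X} → next X ⊆ X → ∀ {l} → ¬ l ∈ˢ X → ¬ Consistent (insert X l)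
    fixed⇒maximal {X} fixed l∉X c with em {P = ∃ (Addable X)}
    ... | yes (m , m∉X , _) = m∉X (fixed (∈⟦⟧⁺ (inj₂ refl)))
    ... | no  none          = none (_ , l∉X , c)

    module _ {base : Subset L} (base-consistent : Consistent base) where
      open Tower base next next-inflationary

      -- Stages form a chain, so the finitely many members used can be replaced by the largest. The
      -- alternative `base` covers lists that single out no index.
      finite⊆join : ∀ {I} {F : I → Subset L} → (∀ i → Stage (F i)) → ∀ {B} →
                    All (_∈ˢ join F) B → All (_∈ˢ base) B ⊎ ∃[ i ] All (_∈ˢ F i) B
      finite⊆join sF [] = inj₁ []
      finite⊆join sF (l∈ ∷ B⊆) with ∈⟦⟧⁻ l∈ | finite⊆join sF B⊆
      ... | inj₁ l∈b       | inj₁ B⊆b       = inj₁ (l∈b ∷ B⊆b)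
      ... | inj₁ l∈b       | inj₂ (i , B⊆F) = inj₂ (i , base⊆ (sF i) l∈b ∷ B⊆F)
      ... | inj₂ (j , l∈F) | inj₁ B⊆b       = inj₂ (j , l∈F ∷ All.map (base⊆ (sF j)) B⊆b)
      ... | inj₂ (j , l∈F) | inj₂ (i , B⊆F) with chain (sF i) (sF j)
      ...   | inj₁ Fi⊆Fj = inj₂ (j , l∈F ∷ All.map Fi⊆Fj B⊆F)
      ...   | inj₂ Fj⊆Fi = inj₂ (i , Fj⊆Fi l∈F ∷ B⊆F)

      stage-consistent : ∀ {X} → Stage X → Consistent X
      stage-consistent (next-stage s) = next-consistent (stage-consistent s)
      stage-consistent (join-stage sF) bad B⊆ with finite⊆join sF B⊆
      ... | inj₁ B⊆b       = base-consistent bad B⊆b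
      ... | inj₂ (i , B⊆F) = stage-consistent (sF i) bad B⊆F

      maximal-extension : ∃[ X ] base ⊆ X × Consistent X ×
        (∀ {l} → ¬ l ∈ˢ X → ∃[ B ] Bad B × All (λ m → m ∈ˢ X ⊎ m ≡ l) B)
      maximal-extension = top , base⊆ top-stage , stage-consistent top-stage ,
        λ l∉ → by-contradiction λ none → fixed⇒maximal top-fixed l∉ λ {B} bad B⊆ →
          none (B , bad , All.map ∈⟦⟧⁻ B⊆)

  -- Valuations from resolution-closed sets of clauses.

  ResolutionClosed : Pred (Clause A) ℓ → Set _
  ResolutionClosed D = ∀ {a B C} → D B → D C → pos a ∈ B → neg a ∈ C →
    ∃[ E ] D E × (∀ {l} → l ∈ E → (l ∈ B × l ≢ pos a) ⊎ (l ∈ C × l ≢ neg a))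

  -- The valuation is read off a maximal set of literals that can be false
  -- together, i.e. that contains no clause of D.
  resolution-complete : {A : Set ℓ} {D : Pred (Clause A) ℓ} → ResolutionClosed D →
    (C : Clause A) → ¬ (∃[ B ] D B × All (_∈ C) B) →
    ∃[ v ] (∀ {B} → D B → Satisfies v B) ×
           (∀ {l} → l ∈ C → D (pos (atom l) ∷ neg (atom l) ∷ []) → value v l ≡ false)
  resolution-complete {A = A} {D} closed C underivable = v , sat , falsifies
    where
    open Maximal D

    extension = maximal-extension {⟦ _∈ C ⟧} λ d B⊆ →
      underivable (_ , d , All.map ∈⟦⟧⁻ B⊆)

    X : Subset (Literal A)
    X = proj₁ extension

    C⊆X : ⟦ _∈ C ⟧ ⊆ X
    C⊆X = proj₁ (proj₂ extension)

    consistent : Consistent X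
    consistent = proj₁ (proj₂ (proj₂ extension))

    -- If both literals were missing, maximality would give two clauses of `D`, each inside `X`
    -- apart from one of the literals. Each contains its literal, by consistency, and a clause of
    -- `D` within their resolvent would lie inside `X`.
    total : ∀ {a} → ¬ pos a ∈ˢ X → ¬ ¬ neg a ∈ˢ X
    total {a} p∉ n∉ with proj₂ (proj₂ (proj₂ extension)) p∉
                       | proj₂ (proj₂ (proj₂ extension)) n∉
    ... | B , dB , B⊆ | C , dC , C⊆ =
        let E , dE , E⊆ = closed dB dC (occurs dB B⊆) (occurs dC C⊆)
        in consistent dE (All.tabulate λ l∈E →
             [ (λ (l∈ , l≢) → [ id , ⊥-elim ∘ l≢ ]′ (All.lookup B⊆ l∈))
             , (λ (l∈ , l≢) → [ id , ⊥-elim ∘ l≢ ]′ (All.lookup C⊆ l∈)) ]′ (E⊆ l∈E))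
      where
      occurs : ∀ {l B} → D B → All (λ m → m ∈ˢ X ⊎ m ≡ l) B → l ∈ B
      occurs {l} {B} d B⊆ = by-contradiction λ l∉B → consistent d (All.tabulate λ m∈B →
        [ id , (λ { refl → ⊥-elim (l∉B m∈B) }) ]′ (All.lookup B⊆ m∈B))

    v : A → Bool
    v a = X (neg a)

    true-outside : ∀ l → ¬ l ∈ˢ X → value v l ≡ true
    true-outside (pos a) p∉ with X (neg a) in eq
    ... | true  = refl
    ... | false = ⊥-elim (total p∉ λ n∈ → case trans (sym eq) n∈ of λ ())
    true-outside (neg a) n∉ with X (neg a)
    ... | true  = ⊥-elim (n∉ refl)
    ... | false = refl

    sat : ∀ {B} → D B → Satisfies v B
    sat {B} d = by-contradiction λ unsat → consistent d (All.tabulate λ {l} l∈B →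
      by-contradiction λ l∉X → unsat (Any.map (λ { refl → true-outside l l∉X }) l∈B))

    -- The tautology in `D` keeps `X` from containing both literals of the atom, so a positive
    -- literal of `C` comes out false.
    falsifies : ∀ {l} → l ∈ C → D (pos (atom l) ∷ neg (atom l) ∷ []) → value v l ≡ false
    falsifies {pos a} l∈C taut with X (neg a) in eq
    ... | false = refl
    ... | true  = ⊥-elim (consistent taut (C⊆X (∈⟦⟧⁺ l∈C) ∷ eq ∷ []))
    falsifies {neg a} l∈C _ = cong not (C⊆X (∈⟦⟧⁺ l∈C))

  -- Derived rules of a calculus with resolution.

  complement : Literal A → Literal A
  complement (pos a) = neg a
  complement (neg a) = pos a

  module Resolution {ℓ} {A : Set ℓ} (Der : Pred (Clause A) ℓ)
    (res  : ∀ {a B C} → Der (pos a ∷ B) → Der (neg a ∷ C) → Der (B ++ C))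
    (resp : ∀ {B C} → B ∼[ set ] C → Der B → Der C) where

    _─_ : Clause A → Literal A → Clause A
    B ─ l = filter (λ m → ¬? (em {P = m ≡ l})) B

    ∈─⁻ : ∀ {B l m} → m ∈ B ─ l → m ∈ B × m ≢ l
    ∈─⁻ = ∈-filter⁻ _

    -- `res` acts on head literals and keeps their later copies, so the copies are merged into the
    -- head first.
    focus : ∀ {B l} → l ∈ B → Der B → Der (l ∷ B ─ l)
    focus {B} {l} l∈B = resp (mk⇔ to from)
      where
      to : ∀ {m} → m ∈ B → m ∈ l ∷ B ─ l
      to {m} m∈B with em {P = m ≡ l}
      ... | yes refl = here refl
      ... | no  m≢l  = there (∈-filter⁺ _ m∈B m≢l)
      from : ∀ {m} → m ∈ l ∷ B ─ l → m ∈ B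
      from (here refl) = l∈B
      from (there m∈)  = proj₁ (∈─⁻ m∈)

    resolve : ∀ {a B C} → pos a ∈ B → neg a ∈ C → Der B → Der C →
              Der (B ─ pos a ++ C ─ neg a)
    resolve p∈B n∈C dB dC = res (focus p∈B dB) (focus n∈C dC)

    ∈resolvent⁻ : ∀ {a B C l} → l ∈ B ─ pos a ++ C ─ neg a →
                  (l ∈ B × l ≢ pos a) ⊎ (l ∈ C × l ≢ neg a)
    ∈resolvent⁻ {a} {B} l∈ = Sum.map ∈─⁻ ∈─⁻ (∈-++⁻ (B ─ pos a) l∈)

    unit-resolve : ∀ {l B} → Der [ complement l ] → Der (l ∷ B) → Der B
    unit-resolve {pos a} u d = subst Der (++-identityʳ _) (res d u)
    unit-resolve {neg a} u d = res u d

    discard : ∀ {q} {Q : Pred (Literal A) q} (Q? : Decidable Q) B →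
              (∀ {l} → l ∈ B → ¬ Q l → Der [ complement l ]) → Der B → Der (filter Q? B)
    discard {Q = Q} Q? B units d = subst Der (++-identityʳ _)
        (go B [] units (subst Der (sym (++-identityʳ B)) d))
      where
      -- `B′` collects the literals that are kept, so that the next literal to examine is always at
      -- the head.
      go : ∀ B B′ → (∀ {l} → l ∈ B → ¬ Q l → Der [ complement l ]) →
           Der (B ++ B′) → Der (filter Q? B ++ B′)
      go []      B′ units d = d
      go (l ∷ B) B′ units d with Q? l
      ... | no ¬q = go B B′ (units ∘ there) (unit-resolve (units (here refl) ¬q) d)
      ... | yes _ = resp (bag-=⇒ (↭⇒∼bag (shift l (filter Q? B) B′)))
                      (go B (l ∷ B′) (units ∘ there)
                        (resp (bag-=⇒ (↭⇒∼bag (↭-sym (shift l B B′)))) d))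

    isolate : ∀ {l B} → l ∈ B → (∀ {m} → m ∈ B → m ≢ l → Der [ complement m ]) →
              Der B → Der [ l ]
    isolate {l} {B} l∈B units d = resp (mk⇔
        (λ m∈ → here (proj₂ (∈-filter⁻ only {xs = B} m∈)))
        λ { (here refl) → ∈-filter⁺ only l∈B refl ; (there ()) })
      (discard only B units d)
      where
      only : Decidable (_≡ l)
      only m = em

  -- Soundness and completeness for classical consequence.

  module _ {ℓ} {A : Set ℓ} {Γ : Theory A} where

    ⊢ᶜ-sound : ∀ {C} → Γ ⊢ᶜ C → Γ ⊨ᶜ C
    ⊢ᶜ-sound (hyp γ) v sat = sat γ
    ⊢ᶜ-sound (ax a) v sat with v a in eq
    ... | true  = here eq
    ... | false = there (here (cong not eq))
    ⊢ᶜ-sound (res {B = B} d e) v sat with ⊢ᶜ-sound d v sat | ⊢ᶜ-sound e v sat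
    ... | there p | _       = Any.++⁺ˡ p
    ... | here _  | there q = Any.++⁺ʳ B q
    ... | here va | here ¬va with () ← trans (sym ¬va) (cong not va)
    ⊢ᶜ-sound (resp B∼C d) v sat with find (⊢ᶜ-sound d v sat)
    ... | _ , l∈B , vl = lose (Equivalence.to B∼C l∈B) vl
    ⊢ᶜ-sound (cW C d) v sat = Any.++⁺ˡ (⊢ᶜ-sound d v sat)

    ⊢ᶜ-complete : ∀ {C} → Γ ⊨ᶜ C → Γ ⊢ᶜ C
    ⊢ᶜ-complete {C} Γ⊨C with em {P = ∃[ B ] (Γ ⊢ᶜ B) × All (_∈ C) B}
    ... | yes (B , d , B⊆C) = resp (absorb B⊆C) (cW C d)
    ... | no  underivable   =
        let v , sat , falsifies = resolution-complete closed C underivable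
            l , l∈C , vl        = find (Γ⊨C v (sat ∘ hyp))
        in case trans (sym vl) (falsifies l∈C (ax (atom l))) of λ ()
      where
      open Resolution (Γ ⊢ᶜ_) res resp
      closed : ResolutionClosed (Γ ⊢ᶜ_)
      closed d e p∈ n∈ = _ , resolve p∈ n∈ d e , ∈resolvent⁻

    ⊢⇒⊢ᵃᵇ : ∀ {C} → Γ ⊢ C → Γ ⊢ᵃᵇ C
    ⊢⇒⊢ᵃᵇ (hyp γ)      = hyp γ
    ⊢⇒⊢ᵃᵇ (ax a)       = ax a
    ⊢⇒⊢ᵃᵇ (res d e)    = res (⊢⇒⊢ᵃᵇ d) (⊢⇒⊢ᵃᵇ e)
    ⊢⇒⊢ᵃᵇ (resp B∼C d) = resp B∼C (⊢⇒⊢ᵃᵇ d)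

  -- Soundness in the three-valued partition of an in-closed semikernel.

  module ClosedSemikernel {ℓ} (G : Graph ℓ) {S : Pred (V G) ℓ}
    (semikernel : Semikernel G S) (inClosed : InClosed G S) where
    open Graph G using (_⟶_)

    Bot : Pred (V G) ℓ
    Bot = ∁ (In[_] G S)

    In∩S : ∀ {x} → In G S x → ¬ S x
    In∩S = proj₂ semikernel

    cover : ∀ x → S x ⊎ In G S x ⊎ Bot x
    cover = Is3Partition.cover (partition-is3Partition G em semikernel)

    -- In-closure in contrapositive form. It places every atom of the clauses generated by a `Bot`
    -- vertex in `Bot`.
    Bot-out : ∀ {x y} → Bot x → x ⟶ y → Bot y
    Bot-out x⊥ x⟶y y∈ = x⊥ (inClosed (_ , y∈ , x⟶y))

    ⊩-bot : ∀ {C x} → Bot x → (∀ {l} → l ∈ C → Bot (atom l)) → partition G S ⊩ C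
    ⊩-bot x⊥ C⊥ = inj₂ (inj₂ ([ C⊥ , C⊥ ]′ , _ , x⊥))

    ⊩-hyp : ∀ {C} → 𝒞 G C → partition G S ⊩ C
    ⊩-hyp (out x ys outs) with cover x
    ... | inj₁ x∈S                     = inj₁ (x , here refl , x∈S)
    ... | inj₂ (inj₁ (y , y∈S , x⟶y)) =
          inj₁ (y , there (∈-map⁺ pos (Equivalence.from (outs y) x⟶y)) , y∈S)
    ... | inj₂ (inj₂ x⊥) = ⊩-bot x⊥ λ
          { (here refl) → x⊥
          ; (there l∈)  → case ∈-map⁻ pos l∈ of λ
              { (y , y∈ys , refl) → Bot-out x⊥ (Equivalence.to (outs y) y∈ys) } }
    ⊩-hyp (conflict {x} {y} x⟶y) with cover x
    ... | inj₁ x∈S         = inj₂ (inj₁ (y , there (here refl) , proj₁ semikernel (x , x∈S , x⟶y)))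
    ... | inj₂ (inj₁ x∈In) = inj₂ (inj₁ (x , here refl , x∈In))
    ... | inj₂ (inj₂ x⊥)   = ⊩-bot x⊥ λ
          { (here refl)         → x⊥
          ; (there (here refl)) → Bot-out x⊥ x⟶y }

    ⊩-ax : ∀ a → partition G S ⊩ pos a ∷ neg a ∷ []
    ⊩-ax a with cover a
    ... | inj₁ a∈S         = inj₁ (a , here refl , a∈S)
    ... | inj₂ (inj₁ a∈In) = inj₂ (inj₁ (a , there (here refl) , a∈In))
    ... | inj₂ (inj₂ a⊥)   = ⊩-bot a⊥ λ { (here refl) → a⊥ ; (there (here refl)) → a⊥ }

    -- The pivot cannot satisfy both parents, nor satisfy one while the other lies in `Bot`. If both
    -- parents lie in `Bot`, so does the resolvent, and the inhabitant of `Bot` makes even an empty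
    -- resolvent hold.
    ⊩-res : ∀ {a B C} → partition G S ⊩ pos a ∷ B → partition G S ⊩ neg a ∷ C →
            partition G S ⊩ B ++ C
    ⊩-res (inj₁ (x , there p , x∈S)) _ = inj₁ (x , ∈-++⁺ˡ p , x∈S)
    ⊩-res (inj₂ (inj₁ (x , there p , x∈In))) _ = inj₂ (inj₁ (x , ∈-++⁺ˡ p , x∈In))
    ⊩-res {B = B} _ (inj₁ (x , there p , x∈S)) = inj₁ (x , ∈-++⁺ʳ B p , x∈S)
    ⊩-res {B = B} _ (inj₂ (inj₁ (x , there p , x∈In))) = inj₂ (inj₁ (x , ∈-++⁺ʳ B p , x∈In))
    ⊩-res (inj₁ (_ , here refl , a∈S)) (inj₂ (inj₁ (_ , here refl , a∈In))) = ⊥-elim (In∩S a∈In a∈S)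
    ⊩-res (inj₁ (_ , here refl , a∈S)) (inj₂ (inj₂ (C⊥ , _))) =
      ⊥-elim (C⊥ (inj₂ (here refl)) (inj₁ a∈S))
    ⊩-res (inj₂ (inj₂ (B⊥ , _))) (inj₂ (inj₁ (_ , here refl , a∈In))) =
      ⊥-elim (B⊥ (inj₁ (here refl)) (inj₂ a∈In))
    ⊩-res {B = B} (inj₂ (inj₂ (B⊥ , x , x⊥))) (inj₂ (inj₂ (C⊥ , _))) = inj₂ (inj₂
      ( [ [ B⊥ ∘ inj₁ ∘ there , C⊥ ∘ inj₁ ∘ there ]′ ∘ ∈-++⁻ B
        , [ B⊥ ∘ inj₂ ∘ there , C⊥ ∘ inj₂ ∘ there ]′ ∘ ∈-++⁻ B ]′
      , x , x⊥))

    ⊩-resp : ∀ {B C} → B ∼[ set ] C → partition G S ⊩ B → partition G S ⊩ C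
    ⊩-resp B∼C (inj₁ (x , x∈B , x∈S)) = inj₁ (x , Equivalence.to B∼C x∈B , x∈S)
    ⊩-resp B∼C (inj₂ (inj₁ (x , x∈B , x∈In))) = inj₂ (inj₁ (x , Equivalence.to B∼C x∈B , x∈In))
    ⊩-resp B∼C (inj₂ (inj₂ (B⊥ , w))) = inj₂ (inj₂
      ( B⊥ ∘ Sum.map (Equivalence.from B∼C) (Equivalence.from B∼C) , w))

    both⇒Bot : ∀ {a} → partition G S ⊩ [ pos a ] → partition G S ⊩ [ neg a ] → Bot a
    both⇒Bot (inj₂ (inj₂ (a⊥ , _))) _ = a⊥ (inj₁ (here refl))
    both⇒Bot _ (inj₂ (inj₂ (a⊥ , _))) = a⊥ (inj₂ (here refl))
    both⇒Bot (inj₁ (_ , here refl , a∈S)) (inj₂ (inj₁ (_ , here refl , a∈In))) _ = In∩S a∈In a∈S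
    both⇒Bot (inj₁ _) (inj₁ (_ , there () , _))
    both⇒Bot (inj₂ (inj₁ (_ , there () , _))) _

    ⊢-sound : ∀ {C} → 𝒞 G ⊢ C → partition G S ⊩ C
    ⊢-sound (hyp γ)      = ⊩-hyp γ
    ⊢-sound (ax a)       = ⊩-ax a
    ⊢-sound (res d e)    = ⊩-res (⊢-sound d) (⊢-sound e)
    ⊢-sound (resp B∼C d) = ⊩-resp B∼C (⊢-sound d)

    Paradoxical⊆Bot : Paradoxical (𝒞 G) ⊑ Bot
    Paradoxical⊆Bot (d , e) = both⇒Bot (⊢-sound d) (⊢-sound e)

    -- The inclusion serves (aW): a premise that holds by lying in `Bot` would have only paradoxical
    -- atoms, against the side condition.
    ⊢ᵃᵇ-sound : Bot ⊑ Paradoxical (𝒞 G) → ∀ {C} → 𝒞 G ⊢ᵃᵇ C → partition G S ⊩ C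
    ⊢ᵃᵇ-sound Bot⊆ (hyp γ)      = ⊩-hyp γ
    ⊢ᵃᵇ-sound Bot⊆ (ax a)       = ⊩-ax a
    ⊢ᵃᵇ-sound Bot⊆ (res d e)    = ⊩-res (⊢ᵃᵇ-sound Bot⊆ d) (⊢ᵃᵇ-sound Bot⊆ e)
    ⊢ᵃᵇ-sound Bot⊆ (resp B∼C d) = ⊩-resp B∼C (⊢ᵃᵇ-sound Bot⊆ d)
    ⊢ᵃᵇ-sound Bot⊆ (aW C ¬par d) with ⊢ᵃᵇ-sound Bot⊆ d
    ... | inj₁ (x , p , x∈S)         = inj₁ (x , ∈-++⁺ˡ p , x∈S)
    ... | inj₂ (inj₁ (x , p , x∈In)) = inj₂ (inj₁ (x , ∈-++⁺ˡ p , x∈In))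
    ... | inj₂ (inj₂ (B⊥ , _))       = ⊥-elim (¬par (All.tabulate λ
          { {pos x} l∈B → Bot⊆ (B⊥ (inj₁ l∈B))
          ; {neg x} l∈B → Bot⊆ (B⊥ (inj₂ l∈B)) }))
    ⊢ᵃᵇ-sound Bot⊆ (bW {[]} B≢[] both) = ⊥-elim (B≢[] refl)
    ⊢ᵃᵇ-sound Bot⊆ (bW {l ∷ B} _ both) = ⊩-bot (bot (here refl)) bot
      where
      bot : ∀ {m} → m ∈ l ∷ B → Bot (atom m)
      bot m∈ = both⇒Bot (⊢ᵃᵇ-sound Bot⊆ (proj₁ (both (∈-map⁺ atom m∈))))
                        (⊢ᵃᵇ-sound Bot⊆ (proj₂ (both (∈-map⁺ atom m∈))))

  -- Paradoxical atoms and models of a finitely branching graph.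

  module Discourse {ℓ} (G : Graph ℓ) (branching : FinitelyBranching G) where
    open Graph G using (_⟶_)

    P : Pred (V G) ℓ
    P = Paradoxical (𝒞 G)

    open Resolution (𝒞 G ⊢_) res resp

    neighbours : V G → List (V G)
    neighbours x = proj₁ (branching x)

    ⟶⇒∈ : ∀ {x y} → x ⟶ y → y ∈ neighbours x
    ⟶⇒∈ = Equivalence.from (proj₂ (branching _) _)

    ∈⇒⟶ : ∀ {x y} → y ∈ neighbours x → x ⟶ y
    ∈⇒⟶ = Equivalence.to (proj₂ (branching _) _)

    outClause : V G → Clause (V G)
    outClause x = pos x ∷ map pos (neighbours x)

    outClause-derivable : ∀ x → 𝒞 G ⊢ outClause x
    outClause-derivable x = hyp (out x (neighbours x) (proj₂ (branching x)))

    -- Resolving `pos x` with the conflict clauses refutes every out-neighbour. Since `x` is refuted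
    -- too, everything but `pos y` can be resolved away from the out-clause of `x`.
    P-out : ∀ {x y} → P x → x ⟶ y → P y
    P-out {x} {y} (px , nx) x⟶y =
      isolate (there (∈-map⁺ pos (⟶⇒∈ x⟶y))) (λ m∈ _ → units m∈) (outClause-derivable x) ,
      refute x⟶y
      where
      refute : ∀ {z} → x ⟶ z → 𝒞 G ⊢ [ neg z ]
      refute x⟶z = res px (hyp (conflict x⟶z))
      units : ∀ {m} → m ∈ outClause x → 𝒞 G ⊢ [ complement m ]
      units (here refl) = nx
      units (there m∈) with ∈-map⁻ pos m∈
      ... | z , z∈ , refl = refute (∈⇒⟶ z∈)

    -- Without the empty clause these clauses are still closed under resolution:
    -- resolving [ pos a ] with [ neg a ] would need a to be paradoxical.
    Definite : Pred (Clause (V G)) ℓ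
    Definite B = (𝒞 G ⊢ B) × All (∁ P ∘ atom) B × B ≢ []

    Definite-closed : ResolutionClosed Definite
    Definite-closed {a} {B} {C} (dB , B-ok , _) (dC , C-ok , _) p∈B n∈C =
      B ─ pos a ++ C ─ neg a ,
      (resolve p∈B n∈C dB dC ,
       All.tabulate ([ All.lookup B-ok ∘ proj₁ , All.lookup C-ok ∘ proj₁ ]′ ∘ ∈resolvent⁻) ,
       λ empty → All.lookup B-ok p∈B
         ( subst (λ E → 𝒞 G ⊢ pos a ∷ E) (++-conicalˡ _ _ empty) (focus p∈B dB)
         , subst (λ E → 𝒞 G ⊢ neg a ∷ E) (++-conicalʳ (B ─ pos a) _ empty) (focus n∈C dC))) ,
      ∈resolvent⁻

    module _ {v : V G → Bool} (sat : ∀ {B} → Definite B → Satisfies v B) where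

      -- `sat` concerns only clauses free of paradoxical atoms, so the values of `v` at paradoxical
      -- atoms are disregarded.
      S : Pred (V G) ℓ
      S x = ¬ P x × v x ≡ true

      independent : ∀ {x y} → S x → S y → ¬ (x ⟶ y)
      independent (¬px , vx) (¬py , vy) x⟶y
        with sat (hyp (conflict x⟶y) , ¬px ∷ ¬py ∷ [] , λ ())
      ... | here ¬vx         = case trans (sym ¬vx) (cong not vx) of λ ()
      ... | there (here ¬vy) = case trans (sym ¬vy) (cong not vy) of λ ()

      In[S]⊆∁P : In[_] G S ⊑ ∁ P
      In[S]⊆∁P (inj₁ (¬px , _))             = ¬px
      In[S]⊆∁P (inj₂ (_ , (¬py , _) , x⟶y)) px = ¬py (P-out px x⟶y)

      -- Resolving the paradoxical literals out of the out-clause of `x` leaves a definite clause,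
      -- nonempty because it still contains `pos x`. If `x` is false, its true literal is an
      -- out-neighbour in `S`.
      ∁P⊆In[S] : ∁ P ⊑ In[_] G S
      ∁P⊆In[S] {x} ¬px with v x in vx
      ... | true  = inj₁ (¬px , refl)
      ... | false = inj₂ (true-neighbour (find (sat (reduced , reduced-ok , nonempty))))
        where
        ok? : Decidable {A = Literal (V G)} (∁ P ∘ atom)
        ok? l = em
        units : ∀ l → ¬ ¬ P (atom l) → 𝒞 G ⊢ [ complement l ]
        units (pos z) ¬¬p = proj₂ (by-contradiction ¬¬p)
        units (neg z) ¬¬p = proj₁ (by-contradiction ¬¬p)
        reduced : 𝒞 G ⊢ filter ok? (outClause x)
        reduced = discard ok? (outClause x) (λ {l} _ → units l) (outClause-derivable x)
        reduced-ok : All (∁ P ∘ atom) (filter ok? (outClause x))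
        reduced-ok = All.tabulate (proj₂ ∘ ∈-filter⁻ ok? {xs = outClause x})
        nonempty : filter ok? (outClause x) ≢ []
        nonempty empty =
          case subst (pos x ∈_) empty (∈-filter⁺ ok? {xs = outClause x} (here refl) ¬px) of λ ()
        true-neighbour : ∃[ l ] l ∈ filter ok? (outClause x) × value v l ≡ true → In G S x
        true-neighbour (l , l∈ , vl) with ∈-filter⁻ ok? {xs = outClause x} l∈
        ... | here refl , _ = case trans (sym vx) vl of λ ()
        ... | there l∈′ , ¬p with ∈-map⁻ pos l∈′
        ...   | y , y∈ , refl = y , (¬p , vl) , ∈⇒⟶ y∈

      Out⊆In : Out G S ⊑ In G S
      Out⊆In {y} (x , x∈S@(¬px , vx) , x⟶y) with em {P = P y}
      ... | no ¬py = [ (λ y∈S → ⊥-elim (independent x∈S y∈S x⟶y)) , id ]′ (∁P⊆In[S] ¬py)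
      -- A paradoxical `y` would resolve the conflict clause to the definite unit `neg x`, which `v`
      -- falsifies.
      ... | yes (py , _) with sat (¬x , ¬px ∷ [] , λ ())
        where
        ¬x : 𝒞 G ⊢ [ neg x ]
        ¬x = isolate (here refl)
          (λ { (here refl) ≢x → ⊥-elim (≢x refl) ; (there (here refl)) _ → py })
          (hyp (conflict x⟶y))
      ...   | here ¬vx = case trans (sym ¬vx) (cong not vx) of λ ()

      model : Mod G S
      model = (Out⊆In , λ { (_ , y∈S , x⟶y) x∈S → independent x∈S y∈S x⟶y })
            , (λ { (y , y∈ , x⟶y) → ∁P⊆In[S] λ px → In[S]⊆∁P y∈ (P-out px x⟶y) })
            , λ { (R , semi , closed , _ , In[R]⊈) → In[R]⊈ λ x∈ → ∁P⊆In[S] λ px →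
                  ClosedSemikernel.Paradoxical⊆Bot G semi closed px x∈ }

    full-model : ∃[ S ] Mod G S × ∁ P ⊑ In[_] G S
    full-model with resolution-complete Definite-closed [] underivable
      where
      underivable : ¬ (∃[ B ] Definite B × All (_∈ []) B)
      underivable ([] , (_ , _ , []≢[]) , _) = []≢[] refl
      underivable (_ ∷ _ , _ , () ∷ _)
    ... | v , sat , _ = S sat , model sat , ∁P⊆In[S] sat

    -- The set `In[ R ]` avoids `P` and hence lies in `In[ S₀ ]` for the full model. A
    -- non-paradoxical vertex outside it would make the inclusion strict, against maximality.
    Mod⇒Bot⊆P : ∀ {R} → Mod G R → ∁ (In[_] G R) ⊑ P
    Mod⇒Bot⊆P {R} (semi , closed , maximal) {x} x⊥ with full-model
    ... | S₀ , (semi₀ , closed₀ , _) , ∁P⊆In[S₀] = by-contradiction λ ¬px →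
      maximal (S₀ , semi₀ , closed₀ ,
        (λ y∈ → ∁P⊆In[S₀] λ py → ClosedSemikernel.Paradoxical⊆Bot G semi closed py y∈) ,
        λ In[S₀]⊆ → x⊥ (In[S₀]⊆ (∁P⊆In[S₀] ¬px)))

    -- Derivability with (aW) and (bW) against truth in all models.

    ⊢ᵃᵇ⇒⊨ : ∀ {C} → 𝒞 G ⊢ᵃᵇ C → G ⊨ C
    ⊢ᵃᵇ⇒⊨ d S M@(semi , closed , _) = ClosedSemikernel.⊢ᵃᵇ-sound G semi closed (Mod⇒Bot⊆P M) d

    derive-paradoxical : ∀ {C} → (∀ {l} → l ∈ C → P (atom l)) → ∃ P → 𝒞 G ⊢ᵃᵇ C
    -- (bW) excludes the empty clause, which comes from the two units of any paradoxical atom.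
    derive-paradoxical {[]}    _  (_ , d , e) = ⊢⇒⊢ᵃᵇ (res d e)
    derive-paradoxical {_ ∷ _} pC _           = bW (λ ()) λ a∈ → case ∈-map⁻ atom a∈ of λ
      { (_ , l∈ , refl) → ⊢⇒⊢ᵃᵇ (proj₁ (pC l∈)) , ⊢⇒⊢ᵃᵇ (proj₂ (pC l∈)) }

    ⊨⇒⊢ᵃᵇ : ∀ {C} → G ⊨ C → 𝒞 G ⊢ᵃᵇ C
    ⊨⇒⊢ᵃᵇ {C} G⊨C with em {P = ∃[ B ] Definite B × All (_∈ C) B}
    ... | yes (B , (d , B-ok , B≢[]) , B⊆C) =
          resp (absorb B⊆C) (aW C (not-all B-ok B≢[]) (⊢⇒⊢ᵃᵇ d))
      where
      not-all : ∀ {B} → All (∁ P ∘ atom) B → B ≢ [] → ¬ All (P ∘ atom) B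
      not-all []        B≢[] _        = B≢[] refl
      not-all (¬p ∷ _) _    (p ∷ _) = ¬p p
    ... | no underivable with resolution-complete Definite-closed C underivable
    ...   | v , sat , falsifies with G⊨C (S sat) (model sat)
    -- For a non-paradoxical atom the axiom is definite, so `v` falsifies its literals in `C`. Thus
    -- `C` can hold in this model only by lying in the ⊥-part.
    ...     | inj₁ (x , x∈C , ¬px , vx) =
              case trans (sym vx) (falsifies x∈C (ax x , ¬px ∷ ¬px ∷ [] , λ ())) of λ ()
    ...     | inj₂ (inj₁ (x , x∈C , x∈In)) = ⊥-elim (proj₂ (proj₁ (model sat)) x∈In (¬px , vx))
      where
      ¬px : ¬ P x
      ¬px = In[S]⊆∁P sat (inj₂ x∈In)
      vx : v x ≡ true
      vx = not-injective (falsifies x∈C (ax x , ¬px ∷ ¬px ∷ [] , λ ()))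
    ...     | inj₂ (inj₂ (C⊥ , x , x⊥)) =
              derive-paradoxical (λ { {pos _} l∈C → Bot⊆P (C⊥ (inj₁ l∈C))
                                    ; {neg _} l∈C → Bot⊆P (C⊥ (inj₂ l∈C)) })
                                 (x , Bot⊆P x⊥)
      where
      Bot⊆P : ∁ (In[_] G (S sat)) ⊑ P
      Bot⊆P = Mod⇒Bot⊆P (model sat)

mainTheorem3 : (∀ {a} → ExcludedMiddle a) →
    (∀ {a b} → Extensionality a b) →
    ∀ {ℓ} (G : Graph ℓ) → FinitelyBranching G →
    (C : Clause (Graph.V G)) →
    ((𝒞 G ⊢ᵃᵇ C) ⇔ (G ⊨ C)) × ((𝒞 G ⊢ᶜ C) ⇔ (𝒞 G ⊨ᶜ C))
mainTheorem3 em ext G branching C = mk⇔ ⊢ᵃᵇ⇒⊨ ⊨⇒⊢ᵃᵇ , mk⇔ ⊢ᶜ-sound ⊢ᶜ-complete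
  where
  open Classical em ext
  open Discourse G branching
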